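{- Let $T$ be a tree (in the sense of the context). (i) If $r,s$ are rotor configurations on $T$ with $r(v)\le s(v)$ for all $v\in V_\rho$, then $E_n(T,r)\ge E_n(T,s)$ for all $n\ge 0$. (ii) $E_n(T,\mathbf 0)\ge \alpha(T)\,n$ for all $n\ge 0$. (iii) $E_n(T,\mathbf b)=0$ for all $n\ge 0$.
   Context: A tree $T$ is an infinite tree with all vertex degrees finite and a distinguished root $\rho$ of degree $1$; $V$ is its vertex set, $V_\rho=V\setminus\{\rho\}$. For $v\in V_\rho$, $v^{(0)}$ is the parent of $v$ (its neighbour on the path to $\rho$) and $v^{(1)},\dots,v^{(b(v))}$ are its $b(v)$ children, labelled so that the fixed cyclic order of neighbours of $v$ is $v^{(0)},v^{(1)},\dots,v^{(b(v))}$; $T$ denotes the tree together with these cyclic orders. A rotor configuration is a map $r:V_\rho\to\{0,1,2,\dots\}$ with $0\le r(v)\le b(v)$, meaning the rotor at $v$ points to $v^{(r(v))}$; the rotor at $\rho$ always points to its only child. Rotor walk: at each step the rotor at the particle's current vertex is advanced to the next neighbour in the cyclic order, and the particle moves to that neighbour. Particles are started one after another at $\rho$: each performs rotor walk until it first returns to $\rho$, or else never returns (then it visits each vertex finitely often and is said to escape to infinity); the next particle starts at $\rho$ with the rotors left by the previous ones. $E_n(T,r)$ is the number of the first $n$ particles that escape to infinity, starting from initial configuration $r$. $\alpha(T)$ is the probability that simple random walk on $T$ started at $\rho$ never returns to $\rho$. $\mathbf 0$ denotes the configuration with $\mathbf 0(v)=0$ for all $v\in V_\rho$, and $\mathbf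 b$ the configuration with $\mathbf b(v)=b(v)$ for all $v\in V_\rho$. -}

module Defs where

open import Data.Nat as ℕ using (ℕ; zero; suc; _≤_; _<_)
open import Data.Integer using (+_)
open import Data.Rational as ℚ using (ℚ; 0ℚ; 1ℚ)
open import Data.List using (List; []; _∷_; map; upTo; foldr)
open import Data.List.Properties using (≡-dec)
open import Data.List.Membership.Propositional using (_∉_)
open import Data.Product using (Σ; ∃; _×_; _,_)
open import Data.Bool using (if_then_else_)
open import Relation.Nullary using (¬_; yes; no; does)
open import Relation.Nullary.Decidable using (⌊_⌋)
open import Relation.Binary.PropositionalEquality using (_≡_; _≢_)

-- Trees.
-- The root ρ has a single child; every vertex of V_ρ is encoded by the
-- word (list of child labels) leading to it from that child, written
-- with the LAST step at the head:  [] is the child of ρ, and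
-- (i ∷ w) is the i-th child of w  (1 ≤ i ≤ b w).  The cyclic order at
-- the vertex w is  parent, child 1, …, child (b w).

data Valid (b : List ℕ → ℕ) : List ℕ → Set where
  valid-[] : Valid b []
  valid-∷  : ∀ {i w} → Valid b w → 1 ≤ i → i ≤ b w → Valid b (i ∷ w)

record Tree : Set where
  field
    b        : List ℕ → ℕ      -- number of children b(v) (only used on valid words)
    infinite : (ws : List (List ℕ)) → ∃ λ w → Valid b w × w ∉ ws
open Tree public

data Vtx : Set where
  ρ    : Vtx
  node : List ℕ → Vtx

Config : Set
Config = List ℕ → ℕ

IsConfig : Tree → Config → Set
IsConfig T r = ∀ w → Valid (b T) w → r w ≤ b T w

𝟎 : Config
𝟎 _ = 0

𝐛 : Tree → Config
𝐛 T = b T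

_≟w_ = ≡-dec ℕ._≟_

nbr : List ℕ → ℕ → Vtx
nbr []      zero    = ρ
nbr (_ ∷ w) zero    = node w
nbr w       (suc i) = node (suc i ∷ w)

State : Set
State = Vtx × Config

pos : State → Vtx
pos (v , _) = v

cfg : State → Config
cfg (_ , r) = r

step : Tree → State → State
step T (ρ , r) = (node [] , r)
step T (node w , r) =
  let k = if ⌊ r w ℕ.≟ b T w ⌋ then 0 else suc (r w)
  in  (nbr w k , λ u → if ⌊ u ≟w w ⌋ then k else r u)

walk : Tree → Config → ℕ → State
walk T r zero    = (ρ , r)
walk T r (suc t) = step T (walk T r t)

Returns : Tree → Config → Config → Set
Returns T r r' = ∃ λ t → 0 < t × pos (walk T r t) ≡ ρ
  × (∀ t' → 0 < t' → t' < t → pos (walk T r t') ≢ ρ)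
  × (∀ u → cfg (walk T r t) u ≡ r' u)

Escapes : Tree → Config → Config → Set
Escapes T r r' = (∀ t → 0 < t → pos (walk T r t) ≢ ρ)
  × (∀ u → ∃ λ t₀ → ∀ t → t₀ ≤ t → cfg (walk T r t) u ≡ r' u)

data Run (T : Tree) : Config → ℕ → ℕ → Config → Set where
  run-0   : ∀ {r} → Run T r 0 0 r
  run-ret : ∀ {r r' r'' n e} → Returns T r r' → Run T r' n e r'' → Run T r (suc n) e r''
  run-esc : ∀ {r r' r'' n e} → Escapes T r r' → Run T r' n e r'' → Run T r (suc n) (suc e) r''

HasE : Tree → Config → ℕ → ℕ → Set
HasE T r n e = ∃ λ r'' → Run T r n e r''

sumℚ : List ℚ → ℚ
sumℚ = foldr ℚ._+_ 0ℚ

invdeg : Tree → List ℕ → ℚ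
invdeg T w = + 1 ℚ./ suc (b T w)

-- p T k v : probability that SRW from ρ is at v at time k without
-- having returned to ρ at any time in 1..k
p : Tree → ℕ → Vtx → ℚ
p T zero ρ        = 1ℚ
p T zero (node _) = 0ℚ
p T (suc k) ρ     = 0ℚ
p T (suc k) (node w) = fromParent w ℚ.+ fromChildren
  where
  fromParent : List ℕ → ℚ
  fromParent []      = p T k ρ            -- ρ has degree 1
  fromParent (i ∷ u) =
    if ⌊ 1 ℕ.≤? i ⌋ then (if ⌊ i ℕ.≤? b T u ⌋ then p T k (node u) ℚ.* invdeg T u else 0ℚ)
    else 0ℚ
  fromChildren : ℚ
  fromChildren = sumℚ (map (λ i → p T k (node (suc i ∷ w)) ℚ.* invdeg T (suc i ∷ w)) (upTo (b T w)))

firstReturn : Tree → ℕ → ℚ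
firstReturn T zero    = 0ℚ
firstReturn T (suc k) = p T k (node []) ℚ.* invdeg T []

R : Tree → ℕ → ℚ
R T k = sumℚ (map (firstReturn T) (upTo (suc k)))

-- α(T) = 1 - lim_k R T k  (= inf_k (1 - R T k)).
-- "α(T) · n ≤ e":
αTimes≤ : Tree → ℕ → ℕ → Set
αTimes≤ T n e = (ε : ℚ) → 0ℚ ℚ.< ε →
  ∃ λ k → (1ℚ ℚ.- R T k) ℚ.* (+ n ℚ./ 1) ℚ.≤ (+ e ℚ./ 1) ℚ.+ ε

{-# OPTIONS --safe #-}
module Submission where

-- Let U v be the number of moves from v to its parent.  A property of a vertex v
-- and of the numbers of moves into and out of v, which survives further moves
-- into v and which the children of v pass to v when the particle is about to
-- leave v upwards, holds along the whole process, including the limit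
-- configurations after escapes, since the counts at each vertex stabilise.
-- (i)   Compare with the counts of the s-process: particles entering v beyond
--       those of the s-process may return, but no others.
-- (ii)  Let h k v be the probability of hitting ρ from v within k steps.  Then
--       U v · h k (parent of v) ≤ (inflow of v) · h k v + η k, where η collects
--       multiples of the increments of k ↦ h k w, so that it has bounded partial
--       sums and becomes arbitrarily small.  At the top vertex, h k = R (k + 1).
-- (iii) If every rotor starts at b, a child receives at most as many particles
--       as its parent returns, so the inflow decreases strictly down a path of
--       vertices that keep a particle.

open import Defs
open import Data.Nat using (ℕ; zero; suc; _+_; _*_; _∸_; _≤_; _<_; _⊔_; z≤n; s≤s; s≤s⁻¹)
import Data.Nat as ℕ
import Data.Nat.Properties as ℕₚ
open import Algebra.Properties.CommutativeSemigroup ℕₚ.+-commutativeSemigroup using (xy∙z≈xz∙y)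
open import Data.Nat.Tactic.RingSolver using (solve-∀)
open import Data.List using (List; []; _∷_; map; upTo; applyUpTo)
open import Data.List.Properties using (∷-injectiveʳ; map-upTo)
open import Data.Integer using (+[1+_]; -[1+_])
import Data.Integer as ℤ
import Data.Integer.Properties as ℤₚ
open import Data.Rational as ℚ using (ℚ; 0ℚ; 1ℚ; mkℚ; toℚᵘ)
import Data.Rational.Properties as ℚₚ
open import Data.Rational.Solver using (module +-*-Solver)
import Data.Rational.Unnormalised as ℚᵘ
import Data.Rational.Unnormalised.Properties as ℚᵘₚ
open import Data.Product using (∃; _×_; _,_; proj₁; proj₂)
open import Data.Sum using (_⊎_; inj₁; inj₂)
open import Data.Bool using (if_then_else_)
open import Data.Unit using (⊤; tt)
open import Data.Empty using (⊥-elim)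
open import Relation.Nullary using (Dec; yes; no)
open import Relation.Nullary.Decidable using (⌊_⌋)
open import Relation.Binary.PropositionalEquality
  using (_≡_; _≢_; refl; sym; trans; cong; cong₂; subst; subst₂; module ≡-Reasoning)

-- Finite sums of naturals and threshold indicators.

∑ : ℕ → (ℕ → ℕ) → ℕ
∑ zero    f = 0
∑ (suc n) f = f 0 + ∑ n (λ i → f (suc i))

∑-cong : ∀ n {f g} → (∀ i → i < n → f i ≡ g i) → ∑ n f ≡ ∑ n g
∑-cong zero    h = refl
∑-cong (suc n) h = cong₂ _+_ (h 0 (s≤s z≤n)) (∑-cong n (λ i i<n → h (suc i) (s≤s i<n)))

∑-mono : ∀ n {f g} → (∀ i → i < n → f i ≤ g i) → ∑ n f ≤ ∑ n g
∑-mono zero    h = z≤n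
∑-mono (suc n) h = ℕₚ.+-mono-≤ (h 0 (s≤s z≤n)) (∑-mono n (λ i i<n → h (suc i) (s≤s i<n)))

∑-+ : ∀ n f g → ∑ n (λ i → f i + g i) ≡ ∑ n f + ∑ n g
∑-+ zero    f g = refl
∑-+ (suc n) f g rewrite ∑-+ n (λ i → f (suc i)) (λ i → g (suc i)) = lem (f 0) (g 0) _ _
  where
  lem : ∀ a b c d → (a + b) + (c + d) ≡ (a + c) + (b + d)
  lem = solve-∀

∑-const : ∀ n c → ∑ n (λ _ → c) ≡ n * c
∑-const zero    c = refl
∑-const (suc n) c = cong (c +_) (∑-const n c)

∑-increment : ∀ n {f g} j → j < n → g j ≡ suc (f j) → (∀ i → i ≢ j → g i ≡ f i) →
  ∑ n g ≡ suc (∑ n f)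
∑-increment (suc n) {f} {g} zero j<n e h =
  cong₂ _+_ e (∑-cong n (λ i _ → h (suc i) (λ ())))
∑-increment (suc n) {f} {g} (suc j) (s≤s j<n) e h =
  trans (cong₂ _+_ (h 0 (λ ())) (∑-increment n j j<n e (λ i i≢j → h (suc i) (λ q → i≢j (ℕₚ.suc-injective q)))))
        (ℕₚ.+-suc (f 0) _)

⟦_≤_⟧ : ℕ → ℕ → ℕ
⟦ zero  ≤ k ⟧     = 1
⟦ suc i ≤ zero ⟧  = 0
⟦ suc i ≤ suc k ⟧ = ⟦ i ≤ k ⟧

⟦≤⟧-yes : ∀ {i k} → i ≤ k → ⟦ i ≤ k ⟧ ≡ 1
⟦≤⟧-yes z≤n     = refl
⟦≤⟧-yes (s≤s p) = ⟦≤⟧-yes p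

⟦≤⟧≤1 : ∀ i k → ⟦ i ≤ k ⟧ ≤ 1
⟦≤⟧≤1 zero    k       = ℕₚ.≤-refl
⟦≤⟧≤1 (suc i) zero    = z≤n
⟦≤⟧≤1 (suc i) (suc k) = ⟦≤⟧≤1 i k

⟦≤⟧-mono : ∀ i {k l} → k ≤ l → ⟦ i ≤ k ⟧ ≤ ⟦ i ≤ l ⟧
⟦≤⟧-mono zero    _           = ℕₚ.≤-refl
⟦≤⟧-mono (suc i) z≤n         = z≤n
⟦≤⟧-mono (suc i) (s≤s p)     = ⟦≤⟧-mono i p

⟦≤⟧-zero : ∀ {i} → 1 ≤ i → ⟦ i ≤ 0 ⟧ ≡ 0
⟦≤⟧-zero (s≤s _) = refl

⟦1+k≤k⟧ : ∀ k → ⟦ suc k ≤ k ⟧ ≡ 0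
⟦1+k≤k⟧ zero    = refl
⟦1+k≤k⟧ (suc k) = ⟦1+k≤k⟧ k

⟦≤⟧-suc : ∀ i k → i ≢ suc k → ⟦ i ≤ suc k ⟧ ≡ ⟦ i ≤ k ⟧
⟦≤⟧-suc zero          k       _ = refl
⟦≤⟧-suc (suc zero)    zero    h = ⊥-elim (h refl)
⟦≤⟧-suc (suc (suc i)) zero    h = refl
⟦≤⟧-suc (suc i)       (suc k) h = ⟦≤⟧-suc i k (λ e → h (cong suc e))

-- Counts the children at or before a rotor in position `k`. It turns a sum of inflows over all
-- children into `b * U + r`.
∑⟦≤⟧ : ∀ n {k} → k ≤ n → ∑ n (λ i → ⟦ suc i ≤ k ⟧) ≡ k
∑⟦≤⟧ zero    z≤n     = refl
∑⟦≤⟧ (suc n) z≤n     = trans (∑-const n 0) (ℕₚ.*-zeroʳ n)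
∑⟦≤⟧ (suc n) (s≤s p) = cong suc (∑⟦≤⟧ n p)

upper-bound : ∀ n (f : ℕ → ℕ) → ∃ λ M → ∀ i → i < n → f i ≤ M
upper-bound zero    f = 0 , λ _ ()
upper-bound (suc n) f with upper-bound n (λ i → f (suc i))
... | M , h = f 0 ⊔ M , λ where
  zero    _         → ℕₚ.m≤m⊔n (f 0) M
  (suc i) (s≤s i<n) → ℕₚ.≤-trans (h i i<n) (ℕₚ.m≤n⊔m (f 0) M)

-- Indicators of the particle's position and rotor updates.

Word : Set
Word = List ℕ

at : Vtx → Word → ℕ
at ρ        v = 0
at (node w) v = if ⌊ v ≟w w ⌋ then 1 else 0

at-≡ : ∀ w → at (node w) w ≡ 1
at-≡ w with w ≟w w
... | yes _ = refl
... | no ¬p = ⊥-elim (¬p refl)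

at-≢ : ∀ {p v} → p ≢ node v → at p v ≡ 0
at-≢ {ρ}          h = refl
at-≢ {node w} {v} h with v ≟w w
... | yes refl = ⊥-elim (h refl)
... | no _     = refl

node-injective : ∀ {v w} → node v ≡ node w → v ≡ w
node-injective refl = refl

∷-≢ : ∀ {i : ℕ} {w : Word} → i ∷ w ≢ w
∷-≢ {w = _ ∷ w} e = ∷-≢ (∷-injectiveʳ e)

nbr-suc : ∀ w k → nbr w (suc k) ≡ node (suc k ∷ w)
nbr-suc []      k = refl
nbr-suc (_ ∷ _) k = refl

override-≡ : ∀ (r : Config) {w k} → (if ⌊ w ≟w w ⌋ then k else r w) ≡ k
override-≡ r {w} with w ≟w w
... | yes _ = refl
... | no ≢w = ⊥-elim (≢w refl)

override-≢ : ∀ (r : Config) {w k} u → u ≢ w → (if ⌊ u ≟w w ⌋ then k else r u) ≡ r u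
override-≢ r {w} u u≢w with u ≟w w
... | yes p = ⊥-elim (u≢w p)
... | no _  = refl

-- Flow balance and an abstract invariant of the rotor process.

module _ (T : Tree) where

  kids : (Word → ℕ) → Word → ℕ
  kids U v = ∑ (b T v) (λ i → U (suc i ∷ v))

  valid-child : ∀ {v i} → Valid (b T) v → i < b T v → Valid (b T) (suc i ∷ v)
  valid-child vv i<b = valid-∷ vv (s≤s z≤n) i<b

-- With U v the number of moves from v to its parent so far, a rotor at v that
-- started at r₀ v and is now at r v has sent U v + ⟦ i ≤ r v ⟧ ∸ ⟦ i ≤ r₀ v ⟧
-- particles to the i-th child.  inflow omits the last, constant, term; so the
-- true inflow into v is inflow v ∸ offset v.
inflow : ℕ → Config → (Word → ℕ) → Word → ℕ
inflow m r U []      = m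
inflow m r U (i ∷ w) = U w + ⟦ i ≤ r w ⟧

offset : Config → Word → ℕ
offset r₀ []      = 0
offset r₀ (i ∷ w) = ⟦ i ≤ r₀ w ⟧

inflow-cong : ∀ m {r r' U U'} v → (∀ {i w} → v ≡ i ∷ w → r w ≡ r' w × U w ≡ U' w) →
  inflow m r U v ≡ inflow m r' U' v
inflow-cong m []      h = refl
inflow-cong m (i ∷ w) h with h refl
... | p , q = cong₂ (λ x y → x + ⟦ i ≤ y ⟧) q p

module Rotor
  (T : Tree) (r₀ : Config) (r₀-ok : IsConfig T r₀)
  (Q : Word → ℕ → ℕ → Set)
  (Q-start : ∀ v → Q v (offset r₀ v) 0)
  (Q-in : ∀ v {x x' y} → x ≤ x' → Q v x y → Q v x' y)
  -- Just before a move up from `v` its rotor is at the last child, so every child has inflow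
  -- `suc y`, where `y` is the old count at `v`. The equation is the balance of `v` with the upward
  -- move already counted.
  (Q-up : ∀ v → Valid (b T) v → ∀ x y (z : ℕ → ℕ) →
    (∀ i → i < b T v → Q (suc i ∷ v) (suc y) (z i)) →
    x + ∑ (b T v) z + r₀ v ≡ suc (b T v) * suc y + offset r₀ v →
    Q v x (suc y))
  where

  private
    V : Word → Set
    V = Valid (b T)

  sent : Config → (Word → ℕ) → Word → ℕ
  sent r U v = suc (b T v) * U v + r v

  -- Arrivals from above and below equal departures, plus one if the particle is at `v`. Each upward
  -- move closes a full turn of the rotor, so `v` has been left `sent r U v ∸ r₀ v` times; the
  -- initial terms are moved across the equation to avoid truncated subtraction.
  Balanced : ℕ → Vtx → Config → (Word → ℕ) → Word → Set
  Balanced m p r U v =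
    inflow m r U v + kids T U v + r₀ v ≡ sent r U v + offset r₀ v + at p v

  record Inv (m : ℕ) (p : Vtx) (r : Config) (U : Word → ℕ) : Set where
    field
      pos-ok   : ∀ {w} → p ≡ node w → V w
      cfg-ok   : IsConfig T r
      balanced : ∀ v → V v → Balanced m p r U v
      bounded  : ∀ v → V v → Q v (inflow m r U v) (U v)
  open Inv public

  start : Inv 0 ρ r₀ (λ _ → 0)
  start = record
    { pos-ok = λ () ; cfg-ok = r₀-ok
    ; balanced = λ v _ → bal v
    ; bounded = λ v _ → subst (λ x → Q v x 0) (sym (start-inflow v)) (Q-start v) }
    where
    start-inflow : ∀ v → inflow 0 r₀ (λ _ → 0) v ≡ offset r₀ v
    start-inflow []      = refl
    start-inflow (i ∷ w) = refl
    bal : ∀ v → Balanced 0 ρ r₀ (λ _ → 0) v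
    bal v rewrite start-inflow v | ∑-const (b T v) 0 | ℕₚ.*-zeroʳ (b T v) = lem (offset r₀ v) (r₀ v)
      where
      lem : ∀ a c → a + 0 + c ≡ c + a + 0
      lem = solve-∀

  balanced-step : ∀ {m m' p p' r r' U U'} v →
    inflow m' r' U' v + kids T U' v ≡ inflow m r U v + kids T U v + at p' v →
    sent r' U' v ≡ sent r U v + at p v →
    Balanced m p r U v → Balanced m' p' r' U' v
  balanced-step {m} {p = p} {p'} {r} {U = U} v arr dep bal =
    trans (cong (_+ r₀ v) arr)
      (trans (xy∙z≈xz∙y (inflow m r U v + kids T U v) (at p' v) (r₀ v))
        (trans (cong (_+ at p' v) bal)
          (trans (lem₂ (sent r U v) (offset r₀ v) (at p v) (at p' v))
            (cong (λ x → x + offset r₀ v + at p' v) (sym dep)))))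
    where
    lem₂ : ∀ a c d e → a + c + d + e ≡ a + d + c + e
    lem₂ = solve-∀

  launch : ∀ {m r U U'} → (∀ u → U' u ≡ U u) → Inv m ρ r U → Inv (suc m) (node []) r U'
  launch {m} {r} {U} {U'} eq I = record
    { pos-ok = λ where refl → valid-[]
    ; cfg-ok = cfg-ok I
    ; balanced = λ v vv → balanced-step {p = ρ} {p' = node []} {r = r} {r' = r} v (arr v)
        (trans (cong (λ x → suc (b T v) * x + r v) (eq v)) (sym (ℕₚ.+-identityʳ _))) (balanced I v vv)
    ; bounded = λ v vv → subst (Q v _) (sym (eq v))
        (Q-in v (subst (inflow m r U v ≤_) (sym (inf v)) (ℕₚ.m≤m+n _ _)) (bounded I v vv)) }
    where
    inf : ∀ v → inflow (suc m) r U' v ≡ inflow m r U v + at (node []) v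
    inf []      = ℕₚ.+-comm 1 m
    inf (i ∷ w) rewrite eq w = sym (ℕₚ.+-identityʳ _)
    arr : ∀ v → inflow (suc m) r U' v + kids T U' v ≡ inflow m r U v + kids T U v + at (node []) v
    arr v = trans (cong₂ _+_ (inf v) (∑-cong (b T v) (λ i _ → eq (suc i ∷ v))))
      (xy∙z≈xz∙y (inflow m r U v) (at (node []) v) (kids T U v))

  -- Only the child that is entered gains inflow, since just its indicator changes; no upward count
  -- moves, so `Q-in` suffices for `bounded`.
  advance : ∀ {m w r r' U U'} → r w ≢ b T w → r' w ≡ suc (r w) → (∀ u → u ≢ w → r' u ≡ r u) →
    (∀ u → U' u ≡ U u) → Inv m (node w) r U → Inv m (node (suc (r w) ∷ w)) r' U'
  advance {m} {w} {r} {r'} {U} {U'} r≢b r'w r'u eq I = record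
    { pos-ok = λ where refl → valid-∷ Vw (s≤s z≤n) rw<b
    ; cfg-ok = ok
    ; balanced = λ v vv → balanced-step {p = node w} {p' = p'} {r = r} {r' = r'} v (arr v) (dep v) (balanced I v vv)
    ; bounded = λ v vv → subst (Q v _) (sym (eq v))
        (Q-in v (subst (inflow m r U v ≤_) (sym (inf v)) (ℕₚ.m≤m+n _ _)) (bounded I v vv)) }
    where
    p' = node (suc (r w) ∷ w)
    Vw = pos-ok I refl
    rw<b = ℕₚ.≤∧≢⇒< (cfg-ok I w Vw) r≢b
    ok : IsConfig T r'
    ok u vu with u ≟w w
    ... | yes refl = subst (_≤ b T u) (sym r'w) rw<b
    ... | no u≢w   = subst (_≤ b T u) (sym (r'u u u≢w)) (cfg-ok I u vu)
    inf : ∀ v → inflow m r' U' v ≡ inflow m r U v + at p' v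
    inf [] = sym (ℕₚ.+-identityʳ m)
    inf (i ∷ u) with (i ∷ u) ≟w (suc (r w) ∷ w)
    ... | yes refl rewrite r'w | eq w | ⟦1+k≤k⟧ (r w) | ⟦≤⟧-yes (ℕₚ.≤-refl {r w}) | ℕₚ.+-identityʳ (U w) = refl
    ... | no iu≢ rewrite eq u = trans (cong (U u +_) (same (u ≟w w))) (sym (ℕₚ.+-identityʳ _))
      where
      same : Dec (u ≡ w) → ⟦ i ≤ r' u ⟧ ≡ ⟦ i ≤ r u ⟧
      same (yes refl) rewrite r'w = ⟦≤⟧-suc i (r w) (λ e → iu≢ (cong (_∷ w) e))
      same (no u≢w) rewrite r'u u u≢w = refl
    arr : ∀ v → inflow m r' U' v + kids T U' v ≡ inflow m r U v + kids T U v + at p' v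
    arr v = trans (cong₂ _+_ (inf v) (∑-cong (b T v) (λ i _ → eq (suc i ∷ v))))
      (xy∙z≈xz∙y (inflow m r U v) (at p' v) (kids T U v))
    dep : ∀ v → sent r' U' v ≡ sent r U v + at (node w) v
    dep v with v ≟w w
    ... | yes refl rewrite r'w | eq w = lem₂ (suc (b T w) * U w) (r w)
      where
      lem₂ : ∀ a c → a + suc c ≡ a + c + 1
      lem₂ = solve-∀
    ... | no v≢w rewrite r'u v v≢w | eq v = sym (ℕₚ.+-identityʳ _)

  -- When the rotor wraps around, the indicator of each child of `w` drops from 1 to 0 while `U w`
  -- gains 1, so no inflow changes. Only the count at `w` grows, and there `Q-up` applies.
  ascend : ∀ {m w r r' U U'} → r w ≡ b T w → r' w ≡ 0 → (∀ u → u ≢ w → r' u ≡ r u) →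
    U' w ≡ suc (U w) → (∀ u → u ≢ w → U' u ≡ U u) → Inv m (node w) r U → Inv m (nbr w 0) r' U'
  ascend {m} {w} {r} {r'} {U} {U'} r≡b r'w r'u U'w U'u I = record
    { pos-ok = parent-ok Vw
    ; cfg-ok = ok
    ; balanced = λ v vv → balanced-step {p = node w} {p' = nbr w 0} {r = r} {r' = r'} v (arr v vv) (dep v) (balanced I v vv)
    ; bounded = λ v vv → subst (λ x → Q v x (U' v)) (sym (inf v vv)) (bnd v vv) }
    where
    Vw = pos-ok I refl
    parent-ok : ∀ {w u} → V w → nbr w 0 ≡ node u → V u
    parent-ok (valid-∷ vw _ _) refl = vw
    ok : IsConfig T r'
    ok u vu with u ≟w w
    ... | yes refl = subst (_≤ b T u) (sym r'w) z≤n
    ... | no u≢w   = subst (_≤ b T u) (sym (r'u u u≢w)) (cfg-ok I u vu)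
    inf : ∀ v → V v → inflow m r' U' v ≡ inflow m r U v
    inf [] vv = refl
    inf (i ∷ u) (valid-∷ vu 1≤i i≤b) with u ≟w w
    ... | yes refl rewrite r'w | U'w | r≡b | ⟦≤⟧-zero 1≤i | ⟦≤⟧-yes i≤b = lem (U w)
      where
      lem : ∀ a → suc a + 0 ≡ a + 1
      lem = solve-∀
    ... | no u≢w rewrite r'u u u≢w | U'u u u≢w = refl
    kid-sum : ∀ v w → V w → U' w ≡ suc (U w) → (∀ u → u ≢ w → U' u ≡ U u) →
      kids T U' v ≡ kids T U v + at (nbr w 0) v
    kid-sum v [] vw U'w U'u =
      trans (∑-cong (b T v) (λ i _ → U'u (suc i ∷ v) (λ ()))) (sym (ℕₚ.+-identityʳ _))
    kid-sum v (suc j ∷ w) (valid-∷ _ _ j<b) U'w U'u with v ≟w w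
    ... | yes refl = trans (∑-increment (b T v) j j<b U'w
                       (λ i i≢j → U'u (suc i ∷ v) (λ where refl → i≢j refl))) (ℕₚ.+-comm 1 _)
    ... | no v≢w = trans (∑-cong (b T v) (λ i _ → U'u (suc i ∷ v) (λ e → v≢w (∷-injectiveʳ e)))) (sym (ℕₚ.+-identityʳ _))
    arr : ∀ v → V v → inflow m r' U' v + kids T U' v ≡ inflow m r U v + kids T U v + at (nbr w 0) v
    arr v vv = trans (cong₂ _+_ (inf v vv) (kid-sum v w Vw U'w U'u)) (sym (ℕₚ.+-assoc (inflow m r U v) _ _))
    dep : ∀ v → sent r' U' v ≡ sent r U v + at (node w) v
    dep v with v ≟w w
    ... | yes refl rewrite r'w | U'w | r≡b = lem (b T w) (U w)
      where
      lem : ∀ a c → suc a * suc c + 0 ≡ suc a * c + a + 1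
      lem = solve-∀
    ... | no v≢w rewrite r'u v v≢w | U'u v v≢w = sym (ℕₚ.+-identityʳ _)
    bnd : ∀ v → V v → Q v (inflow m r U v) (U' v)
    bnd v vv with v ≟w w
    ... | no v≢w rewrite U'u v v≢w = bounded I v vv
    ... | yes refl rewrite U'w = Q-up w vv _ _ (λ i → U (suc i ∷ w))
        (λ i i<b → subst (λ x → Q (suc i ∷ w) x (U (suc i ∷ w))) (child i i<b) (bounded I _ (valid-child T vv i<b)))
        (trans (balanced I w vv) total)
      where
      child : ∀ i → i < b T w → U w + ⟦ suc i ≤ r w ⟧ ≡ suc (U w)
      child i i<b rewrite r≡b | ⟦≤⟧-yes i<b = ℕₚ.+-comm (U w) 1
      lem : ∀ a c d → suc a * c + a + d + 1 ≡ suc a * suc c + d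
      lem = solve-∀
      total : sent r U w + offset r₀ w + at (node w) w ≡ suc (b T w) * suc (U w) + offset r₀ w
      total rewrite r≡b | at-≡ w = lem (b T w) (U w) (offset r₀ w)

  -- Both conditions at `v` depend on finitely many values around `v`; this is what lets them pass
  -- to pointwise limits.
  agree : ∀ {m p p' r r' U U'} v → r' v ≡ r v → U' v ≡ U v →
    inflow m r U v ≡ inflow m r' U' v → kids T U' v ≡ kids T U v → at p' v ≡ at p v →
    Balanced m p r U v × Q v (inflow m r U v) (U v) →
    Balanced m p' r' U' v × Q v (inflow m r' U' v) (U' v)
  agree v e₁ e₂ e₃ e₄ e₅ h rewrite e₁ | e₂ | sym e₃ | e₄ | e₅ = h

  -- The invariant along whole walks, returns, escapes and runs.

  bump : State → Word → ℕ
  bump (ρ      , r) u = 0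
  bump (node w , r) u = if ⌊ r w ℕ.≟ b T w ⌋ then at (node w) u else 0

  ups : Config → (Word → ℕ) → ℕ → Word → ℕ
  ups r U zero    u = U u
  ups r U (suc t) u = ups r U t u + bump (walk T r t) u

  step-inv : ∀ {m U} s → pos s ≢ ρ → Inv m (pos s) (cfg s) U →
    Inv m (pos (step T s)) (cfg (step T s)) (λ u → U u + bump s u)
  step-inv (ρ , r) p≢ρ I = ⊥-elim (p≢ρ refl)
  step-inv {m} {U} (node w , r) _ I with r w ℕ.≟ b T w
  ... | yes r≡b = ascend r≡b (override-≡ r) (override-≢ r) Uw Uu I
    where
    Uw : U w + at (node w) w ≡ suc (U w)
    Uw rewrite at-≡ w = ℕₚ.+-comm (U w) 1
    Uu : ∀ u → u ≢ w → U u + at (node w) u ≡ U u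
    Uu u u≢w rewrite at-≢ {node w} {u} (λ e → u≢w (sym (node-injective e))) = ℕₚ.+-identityʳ _
  ... | no r≢b rewrite nbr-suc w (r w) = advance r≢b (override-≡ r) (override-≢ r) (λ u → ℕₚ.+-identityʳ _) I

  walk-inv : ∀ {m r U} t → (∀ t' → 0 < t' → t' < suc t → pos (walk T r t') ≢ ρ) → Inv m ρ r U →
    Inv (suc m) (pos (walk T r (suc t))) (cfg (walk T r (suc t))) (ups r U (suc t))
  walk-inv         zero    h I = launch (λ u → ℕₚ.+-identityʳ _) I
  walk-inv {r = r} (suc t) h I = step-inv (walk T r (suc t)) (h (suc t) (s≤s z≤n) ℕₚ.≤-refl)
    (walk-inv t (λ t' 0<t' t'<t → h t' 0<t' (ℕₚ.m≤n⇒m≤1+n t'<t)) I)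

  isρ : Vtx → ℕ
  isρ ρ        = 1
  isρ (node _) = 0

  isρ-≢ : ∀ {p} → p ≢ ρ → isρ p ≡ 0
  isρ-≢ {ρ}      h = ⊥-elim (h refl)
  isρ-≢ {node _} h = refl

  -- The vertex `[]` is the only neighbour of `ρ`, so its upward moves are exactly the arrivals at
  -- `ρ`; hence `U []` counts the returned particles.
  bump-[] : ∀ s → bump s [] ≡ isρ (pos (step T s))
  bump-[] (ρ , r) = refl
  bump-[] (node w , r) with r w ℕ.≟ b T w
  bump-[] (node [] , r)      | yes _ = refl
  bump-[] (node (_ ∷ _) , r) | yes _ = refl
  ... | no _ rewrite nbr-suc w (r w) = refl

  ups-[] : ∀ {r U} t → (∀ t' → 0 < t' → t' < suc t → pos (walk T r t') ≢ ρ) → ups r U t [] ≡ U []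
  ups-[] zero h = refl
  ups-[] {r} {U} (suc t) h
    rewrite bump-[] (walk T r t) | isρ-≢ (h (suc t) (s≤s z≤n) ℕₚ.≤-refl)
    = trans (ℕₚ.+-identityʳ _) (ups-[] t (λ t' 0<t' t'<t → h t' 0<t' (ℕₚ.m≤n⇒m≤1+n t'<t)))

  inv-cong : ∀ {m r r' U} → (∀ u → r u ≡ r' u) → Inv m ρ r U → Inv m ρ r' U
  inv-cong {m} {r} {r'} {U} eq I = record
    { pos-ok = λ ()
    ; cfg-ok = λ w vw → subst (_≤ b T w) (eq w) (cfg-ok I w vw)
    ; balanced = λ v vv → proj₁ (both v vv)
    ; bounded  = λ v vv → proj₂ (both v vv) }
    where
    both : ∀ v → V v → _ × _
    both v vv = agree {p = ρ} {p' = ρ} v (sym (eq v)) refl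
      (inflow-cong m v (λ {_} {w} _ → eq w , refl)) refl refl (balanced I v vv , bounded I v vv)

  returns-inv : ∀ {m r r' U} → Returns T r r' → Inv m ρ r U →
    ∃ λ U' → Inv (suc m) ρ r' U' × U' [] ≡ suc (U [])
  returns-inv {m} {r} {r'} {U} (suc t , _ , at-ρ , away , eq) I =
    ups r U (suc t)  ,
    inv-cong eq (subst (λ p → Inv (suc m) p (cfg (walk T r (suc t))) (ups r U (suc t)))
      at-ρ (walk-inv t away I)) ,
    count
    where
    count : ups r U (suc t) [] ≡ suc (U [])
    count rewrite bump-[] (walk T r t) | at-ρ | ups-[] {r} {U} t away = ℕₚ.+-comm (U []) 1

  0<b-parent : ∀ {i w} → V (i ∷ w) → 0 < b T w
  0<b-parent (valid-∷ _ 1≤i i≤b) = ℕₚ.≤-trans 1≤i i≤b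

  -- A visit to a vertex with children moves its rotor; a leaf is left only by
  -- moving to its parent, which has a child.
  escapes-leaves : ∀ {m r r' U} → Escapes T r r' → Inv m ρ r U → ∀ u →
    ∃ λ t₀ → ∀ t → t₀ ≤ t → pos (walk T r t) ≢ node u
  escapes-leaves {m} {r} {r'} {U} (away , settle) I u = at-vertex u refl
    where
    inv : ∀ t → Inv (suc m) (pos (walk T r (suc t))) (cfg (walk T r (suc t))) (ups r U (suc t))
    inv t = walk-inv t (λ t' 0<t' _ → away t' 0<t') I
    moves : ∀ s w → pos s ≡ node w → 0 < b T w → cfg (step T s) w ≢ cfg s w
    moves (node w , q) w refl 0<b e with q w ℕ.≟ b T w | w ≟w w
    ... | yes q≡b | yes _ = ℕₚ.<-irrefl (trans e q≡b) 0<b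
    ... | no _    | yes _ = ℕₚ.1+n≢n e
    ... | _       | no ¬w = ¬w refl
    inner : ∀ u → 0 < b T u → ∃ λ t₀ → ∀ t → t₀ ≤ t → pos (walk T r t) ≢ node u
    inner u 0<b with settle u
    ... | t₀ , h = t₀ , λ t t₀≤t p → moves (walk T r t) u p 0<b
      (trans (h (suc t) (ℕₚ.m≤n⇒m≤1+n t₀≤t)) (sym (h t t₀≤t)))
    up : ∀ s w → pos s ≡ node w → b T w ≡ 0 → cfg s w ≤ b T w → pos (step T s) ≡ nbr w 0
    up (node w , q) w refl b≡0 q≤b with q w ℕ.≟ b T w
    ... | yes _  = refl
    ... | no q≢b = ⊥-elim (q≢b (ℕₚ.≤-antisym q≤b (subst (_≤ q w) (sym b≡0) z≤n)))
    leaf : ∀ t u → pos (walk T r (suc t)) ≡ node u → b T u ≡ 0 → V u × pos (walk T r (suc (suc t))) ≡ nbr u 0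
    leaf t u p b≡0 = Vu , up (walk T r (suc t)) u p b≡0 (cfg-ok (inv t) u Vu)
      where Vu = pos-ok (inv t) p
    at-vertex : ∀ u {n} → b T u ≡ n → ∃ λ t₀ → ∀ t → t₀ ≤ t → pos (walk T r t) ≢ node u
    at-vertex u {suc n} e = inner u (subst (0 <_) (sym e) (s≤s z≤n))
    -- From a leaf `[]` the next step would be a return. The threshold 1 skips time 0, as the
    -- invariant is available only after the launch.
    at-vertex [] {zero} e = 1 , λ where
      (suc t) _ p → away (suc (suc t)) (s≤s z≤n) (proj₂ (leaf t [] p e))
    at-vertex (i ∷ w) {zero} e = at-child (0 ℕ.<? b T w)
      where
      at-child : Dec (0 < b T w) → ∃ λ t₀ → ∀ t → t₀ ≤ t → pos (walk T r t) ≢ node (i ∷ w)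
      at-child (yes 0<b) with inner w 0<b
      ... | t₀ , h = suc t₀ , λ where
        (suc t) (s≤s t₀≤t) p → h (suc (suc t)) (ℕₚ.m≤n⇒m≤1+n (ℕₚ.m≤n⇒m≤1+n t₀≤t)) (proj₂ (leaf t _ p e))
      at-child (no ¬0<b) = 1 , λ where
        (suc t) _ p → ¬0<b (0<b-parent (proj₁ (leaf t _ p e)))

  -- Each counter is eventually constant, because the particle leaves every vertex for good; `U'`
  -- collects the final values. The conditions at `v` are read off at one time by which `v`, its
  -- parent and its children have all settled.
  escapes-inv : ∀ {m r r' U} → Escapes T r r' → Inv m ρ r U →
    ∃ λ U' → Inv (suc m) ρ r' U' × U' [] ≡ U []
  escapes-inv {m} {r} {r'} {U} E@(away , settle) I = U' , final , ups-[] {r} {U} (time []) (λ t 0<t _ → away t 0<t)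
    where
    time : Word → ℕ
    time u = proj₁ (escapes-leaves E I u) ⊔ proj₁ (settle u)
    gone : ∀ u t → time u ≤ t → pos (walk T r t) ≢ node u
    gone u t le = proj₂ (escapes-leaves E I u) t (ℕₚ.≤-trans (ℕₚ.m≤m⊔n _ _) le)
    settled : ∀ u t → time u ≤ t → cfg (walk T r t) u ≡ r' u
    settled u t le = proj₂ (settle u) t (ℕₚ.≤-trans (ℕₚ.m≤n⊔m _ _) le)
    U' : Word → ℕ
    U' u = ups r U (time u) u
    still : ∀ s u → pos s ≢ node u → bump s u ≡ 0
    still (ρ , q)      u h = refl
    still (node w , q) u h with q w ℕ.≟ b T w
    ... | yes _ = at-≢ h
    ... | no _  = refl
    ups-stable : ∀ u t d → time u ≤ t → ups r U (d + t) u ≡ ups r U t u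
    ups-stable u t zero    le = refl
    ups-stable u t (suc d) le
      rewrite still (walk T r (d + t)) u (gone u (d + t) (ℕₚ.≤-trans le (ℕₚ.m≤n+m t d)))
      = trans (ℕₚ.+-identityʳ _) (ups-stable u t d le)
    ups-limit : ∀ u t → time u ≤ t → ups r U t u ≡ U' u
    ups-limit u t le = subst (λ x → ups r U x u ≡ U' u) (ℕₚ.m∸n+n≡m le) (ups-stable u (time u) (t ∸ time u) ℕₚ.≤-refl)
    inv : ∀ t → Inv (suc m) (pos (walk T r (suc t))) (cfg (walk T r (suc t))) (ups r U (suc t))
    inv t = walk-inv t (λ t' 0<t' _ → away t' 0<t') I
    parent-time : Word → ℕ
    parent-time []      = 0
    parent-time (_ ∷ w) = time w
    both : ∀ v → V v → Balanced (suc m) ρ r' U' v × Q v (inflow (suc m) r' U' v) (U' v)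
    both v vv = agree {p = pos (walk T r t)} {p' = ρ} v
      (sym (settled v t le-v)) (sym (ups-limit v t le-v)) (inflow-cong (suc m) v parent)
      (∑-cong (b T v) (λ i i<b → sym (ups-limit (suc i ∷ v) t (le-kid i i<b))))
      (sym (at-≢ (gone v t le-v)))
      (balanced (inv t₁) v vv , bounded (inv t₁) v vv)
      where
      K = upper-bound (b T v) (λ i → time (suc i ∷ v))
      t₁ = time v ⊔ parent-time v ⊔ proj₁ K
      t = suc t₁
      le-v : time v ≤ t
      le-v = ℕₚ.m≤n⇒m≤1+n (ℕₚ.≤-trans (ℕₚ.m≤m⊔n _ (parent-time v)) (ℕₚ.m≤m⊔n _ (proj₁ K)))
      le-parent : parent-time v ≤ t
      le-parent = ℕₚ.m≤n⇒m≤1+n (ℕₚ.≤-trans (ℕₚ.m≤n⊔m (time v) _) (ℕₚ.m≤m⊔n _ (proj₁ K)))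
      le-kid : ∀ i → i < b T v → time (suc i ∷ v) ≤ t
      le-kid i i<b = ℕₚ.m≤n⇒m≤1+n (ℕₚ.≤-trans (proj₂ K i i<b) (ℕₚ.m≤n⊔m _ (proj₁ K)))
      parent : ∀ {i w} → v ≡ i ∷ w → cfg (walk T r t) w ≡ r' w × ups r U t w ≡ U' w
      parent {_} {w} refl = settled w t le-parent , ups-limit w t le-parent
    final : Inv (suc m) ρ r' U'
    final = record
      { pos-ok = λ ()
      ; cfg-ok = λ w vw → subst (_≤ b T w) (settled w (suc (time w)) (ℕₚ.n≤1+n _)) (cfg-ok (inv (time w)) w vw)
      ; balanced = λ v vv → proj₁ (both v vv)
      ; bounded  = λ v vv → proj₂ (both v vv) }

  -- Every particle adds one either to `U []` or to the number of escapes.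
  run-inv : ∀ {m r r' U n e} → Run T r n e r' → Inv m ρ r U →
    ∃ λ U' → Inv (n + m) ρ r' U' × U' [] + e ≡ U [] + n
  run-inv run-0 I = _ , I , refl
  run-inv {m} {r' = r'} {U} {suc n} {e} (run-ret x R) I with returns-inv x I
  ... | U₁ , I₁ , c₁ with run-inv R I₁
  ... | U₂ , I₂ , c₂ = U₂ , subst (λ k → Inv k ρ r' U₂) (ℕₚ.+-suc n m) I₂ ,
    trans c₂ (trans (cong (_+ n) c₁) (sym (ℕₚ.+-suc (U []) n)))
  run-inv {m} {r' = r'} {U} {suc n} {suc e} (run-esc x R) I with escapes-inv x I
  ... | U₁ , I₁ , c₁ with run-inv R I₁
  ... | U₂ , I₂ , c₂ = U₂ , subst (λ k → Inv k ρ r' U₂) (ℕₚ.+-suc n m) I₂ ,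
    trans (ℕₚ.+-suc (U₂ []) e) (trans (cong suc (trans c₂ (cong (_+ n) c₁))) (sym (ℕₚ.+-suc (U []) n)))

  final-inv : ∀ {n e} → HasE T r₀ n e → ∃ λ r → ∃ λ U → Inv n ρ r U × U [] + e ≡ n
  final-inv {n} (r , R) with run-inv R start
  ... | U , I , c = r , U , subst (λ k → Inv k ρ r U) (ℕₚ.+-identityʳ n) I , c

-- With a trivial `Q`, the invariant reduces to flow balance and validity of positions and rotors.
module Counts (T : Tree) (r₀ : Config) (r₀-ok : IsConfig T r₀) =
  Rotor T r₀ r₀-ok (λ _ _ _ → ⊤) (λ _ → tt) (λ _ _ _ → tt) (λ _ _ _ _ _ _ _ → tt)

-- Comparison of two initial configurations.

module Monotone (T : Tree) (r s : Config) (r-ok : IsConfig T r) (s-ok : IsConfig T s)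
  (r≤s : ∀ w → Valid (b T) w → r w ≤ s w) (n : ℕ) where

  private module S = Counts T s s-ok

  module _ {sₑ Uₛ} (I : S.Inv n ρ sₑ Uₛ) where

    -- In terms of true inflows x̂ = x ∸ offset r v and x̂ₛ of the s-process this
    -- reads y ≤ Uₛ v + (x̂ ∸ x̂ₛ): a particle entering v beyond the x̂ₛ of the
    -- s-process may return, but no more than that.
    Dominated : Word → ℕ → ℕ → Set
    Dominated v x y =
      y ≤ Uₛ v + ((x + offset s v) ∸ (inflow n sₑ Uₛ v + offset r v))

    in-mono : ∀ v {x x' y} → x ≤ x' → Dominated v x y → Dominated v x' y
    in-mono v x≤x' h = ℕₚ.≤-trans h (ℕₚ.+-monoʳ-≤ (Uₛ v)
      (ℕₚ.∸-monoˡ-≤ (inflow n sₑ Uₛ v + offset r v) (ℕₚ.+-monoˡ-≤ (offset s v) x≤x')))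

    -- If `suc y ≤ Uₛ v` the bound is immediate. Otherwise `Uₛ v ≤ y`, the truncated subtractions at
    -- the children are exact, and their inequalities can be added and combined with both balances.
    up-step : ∀ v → Valid (b T) v → ∀ x y (z : ℕ → ℕ) →
      (∀ i → i < b T v → Dominated (suc i ∷ v) (suc y) (z i)) →
      x + ∑ (b T v) z + r v ≡ suc (b T v) * suc y + offset r v →
      Dominated v x (suc y)
    up-step v vv x y z dom bal with suc y ℕ.≤? Uₛ v
    ... | yes y<U = ℕₚ.≤-trans y<U (ℕₚ.m≤m+n _ _)
    ... | no  y≮U = subst (_≤ Uₛ v + (X ∸ Y)) (ℕₚ.m+[n∸m]≡n U≤1+y)
        (ℕₚ.+-monoʳ-≤ (Uₛ v) (ℕₚ.m+n≤o⇒m≤o∸n (suc y ∸ Uₛ v) gain))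
      where
      B = b T v
      X = x + offset s v
      Y = inflow n sₑ Uₛ v + offset r v
      xₛ = inflow n sₑ Uₛ v
      U≤y : Uₛ v ≤ y
      U≤y = s≤s⁻¹ (ℕₚ.≰⇒> y≮U)
      U≤1+y : Uₛ v ≤ suc y
      U≤1+y = ℕₚ.m≤n⇒m≤1+n U≤y
      child : ∀ i → i < B →
        z i + ((Uₛ v + ⟦ suc i ≤ sₑ v ⟧) + ⟦ suc i ≤ r v ⟧) ≤ Uₛ (suc i ∷ v) + (suc y + ⟦ suc i ≤ s v ⟧)
      child i i<B = subst (z i + c ≤_) (trans (ℕₚ.+-assoc (Uₛ (suc i ∷ v)) (a ∸ c) c) (cong (Uₛ (suc i ∷ v) +_) (ℕₚ.m∸n+n≡m c≤a)))
          (ℕₚ.+-monoˡ-≤ c (dom i i<B))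
        where
        a = suc y + ⟦ suc i ≤ s v ⟧
        c = (Uₛ v + ⟦ suc i ≤ sₑ v ⟧) + ⟦ suc i ≤ r v ⟧
        -- `Uₛ v ≤ y` leaves room for the indicator of `sₑ v`, and `r≤s` compares the two initial
        -- indicators.
        c≤a : c ≤ a
        c≤a = ℕₚ.+-mono-≤ (subst (Uₛ v + ⟦ suc i ≤ sₑ v ⟧ ≤_) (ℕₚ.+-comm y 1) (ℕₚ.+-mono-≤ U≤y (⟦≤⟧≤1 (suc i) (sₑ v))))
          (⟦≤⟧-mono (suc i) (r≤s v vv))
      total : ∑ B z + ((B * Uₛ v + sₑ v) + r v) ≤ kids T Uₛ v + (B * suc y + s v)
      total = subst₂ _≤_ eqL eqR (∑-mono B child)
        where
        eqL : ∑ B (λ i → z i + ((Uₛ v + ⟦ suc i ≤ sₑ v ⟧) + ⟦ suc i ≤ r v ⟧)) ≡ ∑ B z + ((B * Uₛ v + sₑ v) + r v)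
        eqL rewrite ∑-+ B z (λ i → (Uₛ v + ⟦ suc i ≤ sₑ v ⟧) + ⟦ suc i ≤ r v ⟧)
          | ∑-+ B (λ i → Uₛ v + ⟦ suc i ≤ sₑ v ⟧) (λ i → ⟦ suc i ≤ r v ⟧)
          | ∑-+ B (λ _ → Uₛ v) (λ i → ⟦ suc i ≤ sₑ v ⟧)
          | ∑-const B (Uₛ v) | ∑⟦≤⟧ B (S.cfg-ok I v vv) | ∑⟦≤⟧ B (r-ok v vv) = refl
        eqR : ∑ B (λ i → Uₛ (suc i ∷ v) + (suc y + ⟦ suc i ≤ s v ⟧)) ≡ kids T Uₛ v + (B * suc y + s v)
        eqR rewrite ∑-+ B (λ i → Uₛ (suc i ∷ v)) (λ i → suc y + ⟦ suc i ≤ s v ⟧)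
          | ∑-+ B (λ _ → suc y) (λ i → ⟦ suc i ≤ s v ⟧)
          | ∑-const B (suc y) | ∑⟦≤⟧ B (s-ok v vv) = refl
      -- The balances of v in both processes, added to the bound on the children.
      slack : suc y + (xₛ + offset r v) ≤ x + offset s v + Uₛ v
      slack = ℕₚ.+-cancelʳ-≤ k _ _ (begin
        suc y + (xₛ + offset r v) + k
          ≡⟨ lemL (suc y) xₛ (offset r v) (B * suc y) (∑ B z) (B * Uₛ v) (sₑ v) (r v) (kids T Uₛ v) (s v) ⟩
        (suc B * suc y + offset r v) + (xₛ + kids T Uₛ v + s v) + (∑ B z + ((B * Uₛ v + sₑ v) + r v))
          ≤⟨ ℕₚ.+-monoʳ-≤ ((suc B * suc y + offset r v) + (xₛ + kids T Uₛ v + s v)) total ⟩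
        (suc B * suc y + offset r v) + (xₛ + kids T Uₛ v + s v) + (kids T Uₛ v + (B * suc y + s v))
          ≡⟨ cong₂ (λ p q → p + q + (kids T Uₛ v + (B * suc y + s v))) (sym bal) (S.balanced I v vv) ⟩
        (x + ∑ B z + r v) + (suc B * Uₛ v + sₑ v + offset s v + 0) + (kids T Uₛ v + (B * suc y + s v))
          ≡⟨ lemR x (∑ B z) (r v) (Uₛ v) (B * Uₛ v) (sₑ v) (offset s v) (kids T Uₛ v) (B * suc y) (s v) ⟩
        x + offset s v + Uₛ v + k ∎)
        where
        open ℕₚ.≤-Reasoning
        k = B * suc y + ∑ B z + B * Uₛ v + sₑ v + r v + kids T Uₛ v + s v
        lemL : ∀ a xₛ o c z d e f g h → a + (xₛ + o) + (c + z + d + e + f + g + h) ≡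
          ((a + c) + o) + (xₛ + g + h) + (z + ((d + e) + f))
        lemL = solve-∀
        lemR : ∀ x z f u d e o g c h → (x + z + f) + (u + d + e + o + 0) + (g + (c + h)) ≡
          x + o + u + (c + z + d + e + f + g + h)
        lemR = solve-∀
      gain : suc y ∸ Uₛ v + Y ≤ X
      gain = ℕₚ.+-cancelʳ-≤ (Uₛ v) _ _ (subst (_≤ X + Uₛ v)
        (trans (cong (_+ Y) (sym (ℕₚ.m∸n+n≡m U≤1+y))) (xy∙z≈xz∙y (suc y ∸ Uₛ v) (Uₛ v) Y)) slack)

    private module R = Rotor T r r-ok Dominated (λ _ → z≤n) in-mono up-step

    -- Both processes send exactly `n` particles into `[]`, so the excess term of `Dominated`
    -- vanishes there.
    fewer-returns : ∀ {rₑ Uᵣ} → R.Inv n ρ rₑ Uᵣ → Uᵣ [] ≤ Uₛ []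
    fewer-returns J = subst (_ ≤_) (trans (cong (Uₛ [] +_) (ℕₚ.n∸n≡0 (n + 0))) (ℕₚ.+-identityʳ _)) (R.bounded J [] valid-[])

    fewer-escapes : ∀ {e₁ e₂} → HasE T r n e₁ → Uₛ [] + e₂ ≡ n → e₂ ≤ e₁
    fewer-escapes {e₁} {e₂} h c₂ with R.final-inv h
    ... | _ , Uᵣ , J , c₁ = ℕₚ.+-cancelˡ-≤ (Uₛ []) _ _ (begin
        Uₛ [] + e₂ ≡⟨ trans c₂ (sym c₁) ⟩
        Uᵣ [] + e₁ ≤⟨ ℕₚ.+-monoˡ-≤ e₁ (fewer-returns J) ⟩
        Uₛ [] + e₁ ∎)
      where open ℕₚ.≤-Reasoning

-- The `s`-run is taken to its end first; its final counts are fixed data against which the `r`-run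
-- is followed move by move.
escapes-antitone : (T : Tree) (r s : Config) → IsConfig T r → IsConfig T s →
  (∀ w → Valid (b T) w → r w ≤ s w) →
  ∀ n e₁ e₂ → HasE T r n e₁ → HasE T s n e₂ → e₂ ≤ e₁
escapes-antitone T r s r-ok s-ok r≤s n e₁ e₂ h₁ h₂ with Counts.final-inv T s s-ok h₂
... | _ , _ , I , c = Monotone.fewer-escapes T r s r-ok s-ok r≤s n I h₁ c

-- Recurrence when all rotors start at the last child.

module Full (T : Tree) (n : ℕ) where

  private module F = Counts T (𝐛 T) (λ _ _ → ℕₚ.≤-refl)

  module _ {r U} (I : F.Inv n ρ r U) where

    -- If v kept a particle, U v < x̂ v; a child of v has true inflow at most U v,
    -- so the true inflow x̂ strictly decreases down the tree.
    all-return : ∀ k v → Valid (b T) v → inflow n r U v ≤ k + offset (𝐛 T) v →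
      inflow n r U v ≤ U v + offset (𝐛 T) v
    all-return zero v vv h = ℕₚ.≤-trans h (ℕₚ.m≤n+m _ (U v))
    all-return (suc k) v vv h with inflow n r U v ℕ.≤? U v + offset (𝐛 T) v
    ... | yes q = q
    -- The induction hypothesis, summed over the children, is inserted into the balance of `v`,
    -- whose initial rotor is `B`.
    ... | no ¬q = ℕₚ.+-cancelʳ-≤ (B * U v + r v) _ _ (begin
        x + (B * U v + r v)        ≤⟨ ℕₚ.+-monoʳ-≤ x kids-return ⟩
        x + (kids T U v + B)       ≡⟨ sym (ℕₚ.+-assoc x _ _) ⟩
        x + kids T U v + B         ≡⟨ F.balanced I v vv ⟩
        suc B * U v + r v + o + 0  ≡⟨ lem (U v) (B * U v) (r v) o ⟩
        U v + o + (B * U v + r v)  ∎)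
      where
      open ℕₚ.≤-Reasoning
      B = b T v
      x = inflow n r U v
      o = offset (𝐛 T) v
      lem : ∀ u c d e → u + c + d + e + 0 ≡ u + e + (c + d)
      lem = solve-∀
      -- The failed bound says that `U v` is below the true inflow, itself at most `suc k`. Each
      -- child has offset 1, so its true inflow is at most `U v` and the smaller `k` suffices.
      U≤k : U v ≤ k
      U≤k = s≤s⁻¹ (ℕₚ.+-cancelʳ-≤ o _ _ (ℕₚ.≤-trans (ℕₚ.≰⇒> ¬q) h))
      child : ∀ i → i < B → U v + ⟦ suc i ≤ r v ⟧ ≤ U (suc i ∷ v) + 1
      child i i<B = subst (λ o → U v + ⟦ suc i ≤ r v ⟧ ≤ U (suc i ∷ v) + o) one
        (all-return k (suc i ∷ v) (valid-child T vv i<B)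
          (subst (λ o → U v + ⟦ suc i ≤ r v ⟧ ≤ k + o) (sym one) (ℕₚ.+-mono-≤ U≤k (⟦≤⟧≤1 (suc i) (r v)))))
        where
        one : ⟦ suc i ≤ B ⟧ ≡ 1
        one = ⟦≤⟧-yes i<B
      kids-return : B * U v + r v ≤ kids T U v + B
      kids-return = subst₂ _≤_
        (trans (∑-+ B (λ _ → U v) _) (cong₂ _+_ (∑-const B (U v)) (∑⟦≤⟧ B (F.cfg-ok I v vv))))
        (trans (∑-+ B (λ i → U (suc i ∷ v)) (λ _ → 1)) (cong (kids T U v +_) (trans (∑-const B 1) (ℕₚ.*-identityʳ B))))
        (∑-mono B child)

    no-escape : ∀ {e} → U [] + e ≡ n → e ≡ 0
    no-escape {e} c = ℕₚ.n≤0⇒n≡0 (ℕₚ.+-cancelˡ-≤ (U []) _ _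
      (subst (_≤ U [] + 0) (sym c) (all-return n [] valid-[] (ℕₚ.m≤m+n n 0))))

no-escapes-𝐛 : (T : Tree) → ∀ n e → HasE T (𝐛 T) n e → e ≡ 0
no-escapes-𝐛 T n e h with Counts.final-inv T (𝐛 T) (λ _ _ → ℕₚ.≤-refl) h
... | _ , _ , I , c = Full.no-escape T n I c

-- Naturals inside the rationals.

opaque
  -- Opaque so that `ι n` stays an atom and the normalisation of fractions is not unfolded; `ι-def`
  -- gives access to it.
  ι : ℕ → ℚ
  ι n = ℤ.+ n ℚ./ 1

  ι-def : ∀ n → ι n ≡ ℤ.+ n ℚ./ 1
  ι-def n = refl

ι-/1 : ∀ n → toℚᵘ (ι n) ℚᵘ.≃ ℚᵘ.mkℚᵘ (ℤ.+ n) 0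
ι-/1 n = subst (λ q → toℚᵘ q ℚᵘ.≃ ℚᵘ.mkℚᵘ (ℤ.+ n) 0) (sym (ι-def n)) (ℚₚ.toℚᵘ-fromℚᵘ (ℚᵘ.mkℚᵘ (ℤ.+ n) 0))

ι-+ : ∀ m n → ι (m ℕ.+ n) ≡ ι m ℚ.+ ι n
ι-+ m n = ℚₚ.toℚᵘ-injective (begin
  toℚᵘ (ι (m ℕ.+ n))
    ≈⟨ ι-/1 (m ℕ.+ n) ⟩
  ℚᵘ.mkℚᵘ (ℤ.+ (m ℕ.+ n)) 0
    ≈⟨ ℚᵘ.*≡* (cong (ℤ._* ℤ.+ 1)
         (cong₂ ℤ._+_ (sym (ℤₚ.*-identityʳ (ℤ.+ m))) (sym (ℤₚ.*-identityʳ (ℤ.+ n))))) ⟩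
  ℚᵘ.mkℚᵘ (ℤ.+ m) 0 ℚᵘ.+ ℚᵘ.mkℚᵘ (ℤ.+ n) 0
    ≈⟨ ℚᵘₚ.+-cong (ι-/1 m) (ι-/1 n) ⟨
  toℚᵘ (ι m) ℚᵘ.+ toℚᵘ (ι n)
    ≈⟨ ℚₚ.toℚᵘ-homo-+ (ι m) (ι n) ⟨
  toℚᵘ (ι m ℚ.+ ι n) ∎)
  where open ℚᵘₚ.≃-Reasoning

ι-suc : ∀ n → ι (suc n) ≡ 1ℚ ℚ.+ ι n
ι-suc n = trans (ι-+ 1 n) (cong (ℚ._+ ι n) (ι-def 1))

ι-* : ∀ m n → ι (m ℕ.* n) ≡ ι m ℚ.* ι n
ι-* m n = ℚₚ.toℚᵘ-injective (begin
  toℚᵘ (ι (m ℕ.* n))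
    ≈⟨ ι-/1 (m ℕ.* n) ⟩
  ℚᵘ.mkℚᵘ (ℤ.+ (m ℕ.* n)) 0
    ≈⟨ ℚᵘ.*≡* (cong (ℤ._* ℤ.+ 1) (ℤₚ.pos-* m n)) ⟩
  ℚᵘ.mkℚᵘ (ℤ.+ m) 0 ℚᵘ.* ℚᵘ.mkℚᵘ (ℤ.+ n) 0
    ≈⟨ ℚᵘₚ.*-cong (ι-/1 m) (ι-/1 n) ⟨
  toℚᵘ (ι m) ℚᵘ.* toℚᵘ (ι n)
    ≈⟨ ℚₚ.toℚᵘ-homo-* (ι m) (ι n) ⟨
  toℚᵘ (ι m ℚ.* ι n) ∎)
  where open ℚᵘₚ.≃-Reasoning

ι0-* : ∀ q → ι 0 ℚ.* q ≡ 0ℚ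
ι0-* q = trans (cong (ℚ._* q) (ι-def 0)) (ℚₚ.*-zeroˡ q)

ι-inverse : ∀ n → ι (suc n) ℚ.* (ℤ.+ 1 ℚ./ suc n) ≡ 1ℚ
ι-inverse n = ℚₚ.toℚᵘ-injective (begin
  toℚᵘ (ι (suc n) ℚ.* (ℤ.+ 1 ℚ./ suc n))
    ≈⟨ ℚₚ.toℚᵘ-homo-* (ι (suc n)) (ℤ.+ 1 ℚ./ suc n) ⟩
  toℚᵘ (ι (suc n)) ℚᵘ.* toℚᵘ (ℤ.+ 1 ℚ./ suc n)
    ≈⟨ ℚᵘₚ.*-cong (ι-/1 (suc n)) (ℚₚ.toℚᵘ-fromℚᵘ (ℚᵘ.mkℚᵘ (ℤ.+ 1) n)) ⟩
  ℚᵘ.mkℚᵘ (ℤ.+ suc n) 0 ℚᵘ.* ℚᵘ.mkℚᵘ (ℤ.+ 1) n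
    ≈⟨ ℚᵘ.*≡* (trans (ℤₚ.*-identityʳ _) (trans (ℤₚ.*-identityʳ _)
         (sym (trans (ℤₚ.*-identityˡ _) (cong ℤ.+_ (ℕₚ.*-identityˡ (suc n))))))) ⟩
  ℚᵘ.mkℚᵘ (ℤ.+ 1) 0 ∎)
  where open ℚᵘₚ.≃-Reasoning

ι-nonNeg : ∀ n → ℚ.NonNegative (ι n)
ι-nonNeg n = subst ℚ.NonNegative (sym (ι-def n)) (ℚₚ.normalize-nonNeg n 1)

ι-pos : ∀ n → ℚ.Positive (ι (suc n))
ι-pos n = subst ℚ.Positive (sym (ι-def (suc n))) (ℚₚ.normalize-pos (suc n) 1)

0≤1 : 0ℚ ℚ.≤ 1ℚ
0≤1 = ℚₚ.nonNegative⁻¹ 1ℚ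

0≤ι : ∀ n → 0ℚ ℚ.≤ ι n
0≤ι n = ℚₚ.nonNegative⁻¹ (ι n) {{ι-nonNeg n}}

ι-mono : ∀ {m n} → m ≤ n → ι m ℚ.≤ ι n
ι-mono {m} {n} m≤n = subst (ι m ℚ.≤_) (trans (sym (ι-+ m _)) (cong ι (ℕₚ.m+[n∸m]≡n m≤n)))
  (subst (ℚ._≤ ι m ℚ.+ ι (n ℕ.∸ m)) (ℚₚ.+-identityʳ (ι m)) (ℚₚ.+-monoʳ-≤ (ι m) (0≤ι (n ℕ.∸ m))))

*-nonNeg : ∀ {x y} → 0ℚ ℚ.≤ x → 0ℚ ℚ.≤ y → 0ℚ ℚ.≤ x ℚ.* y
*-nonNeg {x} {y} 0≤x 0≤y = subst (ℚ._≤ x ℚ.* y) (ℚₚ.*-zeroʳ x)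
  (ℚₚ.*-monoˡ-≤-nonNeg x {{ℚ.nonNegative 0≤x}} 0≤y)

+-cancelʳ-≤ : ∀ z {x y} → x ℚ.+ z ℚ.≤ y ℚ.+ z → x ℚ.≤ y
+-cancelʳ-≤ z {x} {y} h = subst₂ ℚ._≤_ (undo x) (undo y) (ℚₚ.+-monoˡ-≤ (ℚ.- z) h)
  where
  undo : ∀ x → x ℚ.+ z ℚ.+ ℚ.- z ≡ x
  undo x = trans (ℚₚ.+-assoc x z (ℚ.- z)) (trans (cong (x ℚ.+_) (ℚₚ.+-inverseʳ z)) (ℚₚ.+-identityʳ x))

-- The denominator of `ε` serves as the factor: the product is the numerator, a positive integer.
archimedean : ∀ {ε} → 0ℚ ℚ.< ε → ∃ λ d → 1ℚ ℚ.≤ ι d ℚ.* ε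
archimedean {ε@(mkℚ (ℤ.+ 0) d _)}      (ℚ.*<* (ℤ.+<+ ()))
archimedean {ε@(mkℚ -[1+ n ] d _)} (ℚ.*<* ())
archimedean {ε@(mkℚ +[1+ n ] d _)} _ = suc d , ℚₚ.toℚᵘ-cancel-≤ (ℚᵘₚ.≤-respʳ-≃
    (ℚᵘₚ.≃-sym (ℚᵘₚ.≃-trans (ℚₚ.toℚᵘ-homo-* (ι (suc d)) ε) (ℚᵘₚ.*-congʳ {toℚᵘ ε} (ι-/1 (suc d)))))
    (ℚᵘ.*≤* (subst₂ ℤ._≤_ (sym (ℤₚ.*-identityˡ _)) (sym (ℤₚ.*-identityʳ _))
      (subst₂ (λ a c → ℤ.+ a ℤ.≤ c) (sym (ℕₚ.*-identityˡ (suc d))) (ℤₚ.pos-* (suc d) (suc n))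
        (ℤ.+≤+ (ℕₚ.m≤m*n (suc d) (suc n)))))))

-- Rational sums and error terms with bounded partial sums.

∑ℚ : ℕ → (ℕ → ℚ) → ℚ
∑ℚ zero    f = 0ℚ
∑ℚ (suc n) f = f 0 ℚ.+ ∑ℚ n (λ i → f (suc i))

sumℚ-upTo : ∀ n f → sumℚ (map f (upTo n)) ≡ ∑ℚ n f
sumℚ-upTo n f = trans (cong sumℚ (map-upTo f n)) (go n f)
  where
  go : ∀ n f → sumℚ (applyUpTo f n) ≡ ∑ℚ n f
  go zero    f = refl
  go (suc n) f = cong (f 0 ℚ.+_) (go n (λ i → f (suc i)))

∑ℚ-cong : ∀ n {f g} → (∀ i → i < n → f i ≡ g i) → ∑ℚ n f ≡ ∑ℚ n g
∑ℚ-cong zero    h = refl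
∑ℚ-cong (suc n) h = cong₂ ℚ._+_ (h 0 (s≤s z≤n)) (∑ℚ-cong n (λ i i<n → h (suc i) (s≤s i<n)))

∑ℚ-mono : ∀ n {f g} → (∀ i → i < n → f i ℚ.≤ g i) → ∑ℚ n f ℚ.≤ ∑ℚ n g
∑ℚ-mono zero    h = ℚₚ.≤-refl
∑ℚ-mono (suc n) h = ℚₚ.+-mono-≤ (h 0 (s≤s z≤n)) (∑ℚ-mono n (λ i i<n → h (suc i) (s≤s i<n)))

∑ℚ-0 : ∀ n → ∑ℚ n (λ _ → 0ℚ) ≡ 0ℚ
∑ℚ-0 zero    = refl
∑ℚ-0 (suc n) = trans (ℚₚ.+-identityˡ _) (∑ℚ-0 n)

∑ℚ-1 : ∀ n → ∑ℚ n (λ _ → 1ℚ) ≡ ι n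
∑ℚ-1 zero    = sym (ι-def 0)
∑ℚ-1 (suc n) = trans (cong (1ℚ ℚ.+_) (∑ℚ-1 n)) (sym (ι-suc n))

∑ℚ-nonNeg : ∀ n {f} → (∀ i → 0ℚ ℚ.≤ f i) → 0ℚ ℚ.≤ ∑ℚ n f
∑ℚ-nonNeg n h = subst (ℚ._≤ ∑ℚ n _) (∑ℚ-0 n) (∑ℚ-mono n (λ i _ → h i))

∑ℚ-+ : ∀ n f g → ∑ℚ n (λ i → f i ℚ.+ g i) ≡ ∑ℚ n f ℚ.+ ∑ℚ n g
∑ℚ-+ zero    f g = refl
∑ℚ-+ (suc n) f g = trans (cong ((f 0 ℚ.+ g 0) ℚ.+_) (∑ℚ-+ n (λ i → f (suc i)) (λ i → g (suc i))))
  (solve 4 (λ a c d e → (a :+ c) :+ (d :+ e) := (a :+ d) :+ (c :+ e)) refl (f 0) (g 0) _ _)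
  where open +-*-Solver

∑ℚ-*ˡ : ∀ n c f → ∑ℚ n (λ i → c ℚ.* f i) ≡ c ℚ.* ∑ℚ n f
∑ℚ-*ˡ zero    c f = sym (ℚₚ.*-zeroʳ c)
∑ℚ-*ˡ (suc n) c f = trans (cong (c ℚ.* f 0 ℚ.+_) (∑ℚ-*ˡ n c (λ i → f (suc i)))) (sym (ℚₚ.*-distribˡ-+ c (f 0) _))

∑ℚ-swap : ∀ m n (f : ℕ → ℕ → ℚ) → ∑ℚ m (λ i → ∑ℚ n (f i)) ≡ ∑ℚ n (λ j → ∑ℚ m (λ i → f i j))
∑ℚ-swap zero    n f = sym (∑ℚ-0 n)
∑ℚ-swap (suc m) n f = trans (cong (∑ℚ n (f 0) ℚ.+_) (∑ℚ-swap m n (λ i → f (suc i))))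
  (sym (∑ℚ-+ n (f 0) (λ j → ∑ℚ m (λ i → f (suc i) j))))

∑ℚ-last : ∀ n f → ∑ℚ (suc n) f ≡ ∑ℚ n f ℚ.+ f n
∑ℚ-last zero    f = ℚₚ.+-comm (f 0) 0ℚ
∑ℚ-last (suc n) f = trans (cong (f 0 ℚ.+_) (∑ℚ-last n (λ i → f (suc i)))) (sym (ℚₚ.+-assoc (f 0) _ _))

-- A constructive substitute for a vanishing error: no limit is asserted, yet some term falls below
-- any given `ε`. The class is closed under the operations by which errors are combined up the tree.
BoundedSums : (ℕ → ℚ) → Set
BoundedSums η = ∃ λ C → ∀ K → ∑ℚ K η ℚ.≤ ι C

BoundedSums-0 : BoundedSums (λ _ → 0ℚ)
BoundedSums-0 = 0 , λ K → ℚₚ.≤-reflexive (trans (∑ℚ-0 K) (sym (ι-def 0)))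

BoundedSums-+ : ∀ {η θ} → BoundedSums η → BoundedSums θ → BoundedSums (λ k → η k ℚ.+ θ k)
BoundedSums-+ {η} {θ} (C , h) (D , g) = C ℕ.+ D , λ K →
  subst₂ ℚ._≤_ (sym (∑ℚ-+ K η θ)) (sym (ι-+ C D)) (ℚₚ.+-mono-≤ (h K) (g K))

BoundedSums-* : ∀ c {η} → BoundedSums η → BoundedSums (λ k → ι c ℚ.* η k)
BoundedSums-* c {η} (C , h) = c ℕ.* C , λ K →
  subst₂ ℚ._≤_ (sym (∑ℚ-*ˡ K (ι c) η)) (sym (ι-* c C)) (ℚₚ.*-monoˡ-≤-nonNeg (ι c) {{ι-nonNeg c}} (h K))

small-term : ∀ {η ε} → BoundedSums η → 0ℚ ℚ.< ε → ∃ λ k → η k ℚ.≤ ε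
small-term {η} {ε} (C , h) 0<ε with archimedean 0<ε
... | d , 1≤dε = found (search K η)
  where
  -- If the first `K` terms all exceeded `ε`, their sum would be at least `K * ε ≥ C + 1`,
  -- contradicting the bound `C`.
  K = suc C ℕ.* d
  search : ∀ K (η : ℕ → ℚ) → (∃ λ k → η k ℚ.≤ ε) ⊎ ι K ℚ.* ε ℚ.≤ ∑ℚ K η
  search zero    η = inj₂ (ℚₚ.≤-reflexive (ι0-* ε))
  search (suc K) η with η 0 ℚ.≤? ε | search K (λ k → η (suc k))
  ... | yes q | _ = inj₁ (0 , q)
  ... | no _  | inj₁ (k , q) = inj₁ (suc k , q)
  ... | no ¬q | inj₂ q = inj₂ (subst (ℚ._≤ ∑ℚ (suc K) η)
      (sym (trans (cong (ℚ._* ε) (ι-suc K)) (trans (ℚₚ.*-distribʳ-+ ε 1ℚ (ι K)) (cong (ℚ._+ ι K ℚ.* ε) (ℚₚ.*-identityˡ ε)))))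
      (ℚₚ.+-mono-≤ (ℚₚ.<⇒≤ (ℚₚ.≰⇒> ¬q)) q))
  big : ι (suc C) ℚ.≤ ι K ℚ.* ε
  big = subst₂ ℚ._≤_ (ℚₚ.*-identityʳ (ι (suc C)))
    (trans (sym (ℚₚ.*-assoc (ι (suc C)) (ι d) ε)) (cong (ℚ._* ε) (sym (ι-* (suc C) d))))
    (ℚₚ.*-monoˡ-≤-nonNeg (ι (suc C)) {{ι-nonNeg (suc C)}} 1≤dε)
  found : (∃ λ k → η k ℚ.≤ ε) ⊎ ι K ℚ.* ε ℚ.≤ ∑ℚ K η → ∃ λ k → η k ℚ.≤ ε
  found (inj₁ q) = q
  found (inj₂ q) = ⊥-elim (ℚₚ.<-irrefl refl (ℚₚ.<-≤-trans 0<1 (+-cancelʳ-≤ (ι C)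
    (subst₂ ℚ._≤_ (ι-suc C) (sym (ℚₚ.+-identityˡ (ι C))) (ℚₚ.≤-trans big (ℚₚ.≤-trans q (h K)))))))
    where
    0<1 : 0ℚ ℚ.< 1ℚ
    0<1 = ℚ.*<* (ℤ.+<+ (s≤s z≤n))

-- With d = deg v and y the number of moves out of v along each edge: the flow
-- inequality for the children of v becomes the one for v.
transfer : ∀ {d y x z p s η a f} → d ℕ.* y ≡ x ℕ.+ z → ι d ℚ.* (a ℚ.+ f) ≡ p ℚ.+ s →
  ι z ℚ.* a ℚ.≤ ι y ℚ.* s ℚ.+ η →
  ι y ℚ.* p ℚ.≤ ι x ℚ.* a ℚ.+ (η ℚ.+ ι (d ℕ.* y) ℚ.* f)
transfer {d} {y} {x} {z} {p} {s} {η} {a} {f} bal rec kids = +-cancelʳ-≤ (ι y ℚ.* s) (begin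
  ι y ℚ.* p ℚ.+ ι y ℚ.* s
    ≡⟨ sym (ℚₚ.*-distribˡ-+ (ι y) p s) ⟩
  ι y ℚ.* (p ℚ.+ s)
    ≡⟨ cong (ι y ℚ.*_) (sym rec) ⟩
  ι y ℚ.* (ι d ℚ.* (a ℚ.+ f))
    ≡⟨ solve 4 (λ y d a f → y :* (d :* (a :+ f)) := (d :* y) :* a :+ (d :* y) :* f) refl (ι y) (ι d) a f ⟩
  (ι d ℚ.* ι y) ℚ.* a ℚ.+ (ι d ℚ.* ι y) ℚ.* f
    ≡⟨ cong (λ q → q ℚ.* a ℚ.+ q ℚ.* f) (sym (ι-* d y)) ⟩
  ι (d ℕ.* y) ℚ.* a ℚ.+ E
    ≡⟨ cong (λ q → q ℚ.* a ℚ.+ E) (trans (cong ι bal) (ι-+ x z)) ⟩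
  (ι x ℚ.+ ι z) ℚ.* a ℚ.+ E
    ≡⟨ cong (ℚ._+ E) (ℚₚ.*-distribʳ-+ a (ι x) (ι z)) ⟩
  ι x ℚ.* a ℚ.+ ι z ℚ.* a ℚ.+ E
    ≤⟨ ℚₚ.+-monoˡ-≤ E (ℚₚ.+-monoʳ-≤ (ι x ℚ.* a) kids) ⟩
  ι x ℚ.* a ℚ.+ (ι y ℚ.* s ℚ.+ η) ℚ.+ E
    ≡⟨ solve 4 (λ a c d e → a :+ (c :+ d) :+ e := (a :+ (d :+ e)) :+ c) refl (ι x ℚ.* a) (ι y ℚ.* s) η E ⟩
  ι x ℚ.* a ℚ.+ (η ℚ.+ E) ℚ.+ ι y ℚ.* s ∎)
  where
  open ℚₚ.≤-Reasoning
  open +-*-Solver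
  E = ι (d ℕ.* y) ℚ.* f

complement : ∀ {q ε u e n} → u ℕ.+ e ≡ n → ι u ℚ.≤ ι n ℚ.* q ℚ.+ ε →
  (1ℚ ℚ.- q) ℚ.* (ℤ.+ n ℚ./ 1) ℚ.≤ (ℤ.+ e ℚ./ 1) ℚ.+ ε
complement {q} {ε} {u} {e} {n} c returns =
  subst₂ (λ N E → (1ℚ ℚ.- q) ℚ.* N ℚ.≤ E ℚ.+ ε) (ι-def n) (ι-def e) (begin
  (1ℚ ℚ.- q) ℚ.* ι n
    ≡⟨ solve 2 (λ q n → (con 1ℚ :- q) :* n := n :- n :* q) refl q (ι n) ⟩
  ι n ℚ.- ι n ℚ.* q
    ≡⟨ cong (ℚ._- ι n ℚ.* q) (trans (cong ι (sym c)) (ι-+ u e)) ⟩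
  ι u ℚ.+ ι e ℚ.- ι n ℚ.* q
    ≤⟨ ℚₚ.+-monoˡ-≤ (ℚ.- (ι n ℚ.* q)) (ℚₚ.+-monoˡ-≤ (ι e) returns) ⟩
  ι n ℚ.* q ℚ.+ ε ℚ.+ ι e ℚ.- ι n ℚ.* q
    ≡⟨ solve 3 (λ a c d → a :+ c :+ d :- a := d :+ c) refl (ι n ℚ.* q) ε (ι e) ⟩
  ι e ℚ.+ ε ∎)
  where
  open ℚₚ.≤-Reasoning
  open +-*-Solver

-- Hitting probabilities as a potential, and the lower bound by `α`.

module Hitting (T : Tree) where

  -- By reversibility, φ k v is also the probability that simple random walk
  -- started at v first hits ρ at time k, and h k v that it does so by time k.
  φ : ℕ → Vtx → ℚ
  φ k ρ        = p T k ρ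
  φ k (node w) = p T k (node w) ℚ.* invdeg T w

  h : ℕ → Vtx → ℚ
  h k v = ∑ℚ (suc k) (λ j → φ j v)

  deg : Word → ℚ
  deg w = ι (suc (b T w))

  p-nonNeg : ∀ k v → 0ℚ ℚ.≤ p T k v
  φ-nonNeg : ∀ k v → 0ℚ ℚ.≤ φ k v
  p-nonNeg zero    ρ        = 0≤1
  p-nonNeg zero    (node _) = ℚₚ.≤-refl
  p-nonNeg (suc k) ρ        = ℚₚ.≤-refl
  p-nonNeg (suc k) (node []) =
    ℚₚ.+-mono-≤ {0ℚ} {_} {0ℚ} (p-nonNeg k ρ) (subst (0ℚ ℚ.≤_)
      (sym (sumℚ-upTo (b T []) _)) (∑ℚ-nonNeg (b T []) (λ i → φ-nonNeg k (node (suc i ∷ [])))))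
  p-nonNeg (suc k) (node (i ∷ u)) =
    ℚₚ.+-mono-≤ {0ℚ} {_} {0ℚ} from-parent (subst (0ℚ ℚ.≤_)
      (sym (sumℚ-upTo (b T (i ∷ u)) _)) (∑ℚ-nonNeg (b T (i ∷ u)) (λ j → φ-nonNeg k (node (suc j ∷ i ∷ u)))))
    where
    from-parent : 0ℚ ℚ.≤ (if ⌊ 1 ℕ.≤? i ⌋ then (if ⌊ i ℕ.≤? b T u ⌋ then φ k (node u) else 0ℚ) else 0ℚ)
    from-parent with 1 ℕ.≤? i | i ℕ.≤? b T u
    ... | yes _ | yes _ = φ-nonNeg k (node u)
    ... | yes _ | no _  = ℚₚ.≤-refl
    ... | no _  | _     = ℚₚ.≤-refl
  φ-nonNeg k ρ        = p-nonNeg k ρ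
  φ-nonNeg k (node w) = *-nonNeg (p-nonNeg k (node w))
    (ℚₚ.nonNegative⁻¹ (invdeg T w) {{ℚₚ.normalize-nonNeg 1 (suc (b T w))}})

  h-nonNeg : ∀ k v → 0ℚ ℚ.≤ h k v
  h-nonNeg k v = ∑ℚ-nonNeg (suc k) (λ j → φ-nonNeg j v)

  p-rec : ∀ k {w} → Valid (b T) w →
    p T (suc k) (node w) ≡ φ k (nbr w 0) ℚ.+ ∑ℚ (b T w) (λ i → φ k (node (suc i ∷ w)))
  p-rec k valid-[] = cong (p T k ρ ℚ.+_) (sumℚ-upTo (b T []) _)
  p-rec k {i ∷ u} (valid-∷ _ 1≤i i≤b) = cong₂ ℚ._+_ from-parent (sumℚ-upTo (b T (i ∷ u)) _)
    where
    from-parent : (if ⌊ 1 ℕ.≤? i ⌋ then (if ⌊ i ℕ.≤? b T u ⌋ then φ k (node u) else 0ℚ) else 0ℚ) ≡ φ k (node u)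
    from-parent with 1 ℕ.≤? i | i ℕ.≤? b T u
    ... | yes _   | yes _   = refl
    ... | yes _   | no ¬i≤b = ⊥-elim (¬i≤b i≤b)
    ... | no ¬1≤i | _       = ⊥-elim (¬1≤i 1≤i)

  deg-φ : ∀ k w → deg w ℚ.* φ k (node w) ≡ p T k (node w)
  deg-φ k w = trans (solve 3 (λ d x y → d :* (x :* y) := x :* (d :* y)) refl (deg w) (p T k (node w)) (invdeg T w))
    (trans (cong (p T k (node w) ℚ.*_) (ι-inverse (b T w))) (ℚₚ.*-identityʳ _))
    where open +-*-Solver

  φ-0 : ∀ w → φ 0 (node w) ≡ 0ℚ
  φ-0 w = ℚₚ.*-zeroˡ (invdeg T w)

  h-shift : ∀ k w → h (suc k) (node w) ≡ ∑ℚ (suc k) (λ j → φ (suc j) (node w))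
  h-shift k w = trans (cong (ℚ._+ ∑ℚ (suc k) (λ j → φ (suc j) (node w))) (φ-0 w)) (ℚₚ.+-identityˡ _)

  h-suc : ∀ k v → h (suc k) v ≡ h k v ℚ.+ φ (suc k) v
  h-suc k v = ∑ℚ-last (suc k) (λ j → φ j v)

  h-ρ : ∀ k → h k ρ ≡ 1ℚ
  h-ρ k = cong (1ℚ ℚ.+_) (∑ℚ-0 k)

  -- First-step analysis at `w`. It comes from the forward recursion of `p`, since `deg w` times `φ`
  -- is `p`; summing over time and exchanging the sums gives the claim, the time 0 term being zero.
  h-rec : ∀ k {w} → Valid (b T) w →
    deg w ℚ.* h (suc k) (node w) ≡ h k (nbr w 0) ℚ.+ ∑ℚ (b T w) (λ i → h k (node (suc i ∷ w)))
  h-rec k {w} vw = begin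
    deg w ℚ.* h (suc k) (node w)
      ≡⟨ cong (deg w ℚ.*_) (h-shift k w) ⟩
    deg w ℚ.* ∑ℚ (suc k) (λ j → φ (suc j) (node w))
      ≡⟨ sym (∑ℚ-*ˡ (suc k) (deg w) (λ j → φ (suc j) (node w))) ⟩
    ∑ℚ (suc k) (λ j → deg w ℚ.* φ (suc j) (node w))
      ≡⟨ ∑ℚ-cong (suc k) (λ j _ → trans (deg-φ (suc j) w) (p-rec j vw)) ⟩
    ∑ℚ (suc k) (λ j → φ j (nbr w 0) ℚ.+ ∑ℚ (b T w) (λ i → φ j (node (suc i ∷ w))))
      ≡⟨ ∑ℚ-+ (suc k) (λ j → φ j (nbr w 0)) (λ j → ∑ℚ (b T w) (λ i → φ j (node (suc i ∷ w)))) ⟩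
    h k (nbr w 0) ℚ.+ ∑ℚ (suc k) (λ j → ∑ℚ (b T w) (λ i → φ j (node (suc i ∷ w))))
      ≡⟨ cong (h k (nbr w 0) ℚ.+_) (∑ℚ-swap (suc k) (b T w) (λ j i → φ j (node (suc i ∷ w)))) ⟩
    h k (nbr w 0) ℚ.+ ∑ℚ (b T w) (λ i → h k (node (suc i ∷ w))) ∎
    where open ≡-Reasoning

  h≤1 : ∀ k {w} → Valid (b T) w → h k (node w) ℚ.≤ 1ℚ
  h≤1 zero {w} vw = subst (ℚ._≤ 1ℚ) (sym (trans (ℚₚ.+-identityʳ _) (φ-0 w))) 0≤1
  h≤1 (suc k) {w} vw = ℚₚ.*-cancelˡ-≤-pos (deg w) {{ι-pos (b T w)}}
    (subst₂ ℚ._≤_ (sym (h-rec k vw)) total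
      (ℚₚ.+-mono-≤ (parent vw) (∑ℚ-mono (b T w) (λ i i<b → h≤1 k (valid-∷ vw (s≤s z≤n) i<b)))))
    where
    parent : ∀ {w} → Valid (b T) w → h k (nbr w 0) ℚ.≤ 1ℚ
    parent valid-[]         = ℚₚ.≤-reflexive (h-ρ k)
    parent (valid-∷ vu _ _) = h≤1 k vu
    total : 1ℚ ℚ.+ ∑ℚ (b T w) (λ _ → 1ℚ) ≡ deg w ℚ.* 1ℚ
    total = trans (cong (1ℚ ℚ.+_) (∑ℚ-1 (b T w))) (trans (sym (ι-suc (b T w))) (sym (ℚₚ.*-identityʳ (deg w))))

  -- The partial sums are the values `h K (node w)`, which are at most 1.
  φ-summable : ∀ {w} → Valid (b T) w → BoundedSums (λ k → φ (suc k) (node w))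
  φ-summable {w} vw = 1 , λ K → subst₂ ℚ._≤_ 
    (trans (cong (ℚ._+ ∑ℚ K (λ k → φ (suc k) (node w))) (φ-0 w)) (ℚₚ.+-identityˡ _)) (sym (ι-def 1)) (h≤1 K vw)

  -- The index shift is the first step of the walk, from `ρ` to its child.
  h-R : ∀ k → h k (node []) ≡ R T (suc k)
  h-R k = sym (trans (sumℚ-upTo (suc (suc k)) (firstReturn T)) (ℚₚ.+-identityˡ _))

  -- The potential carried out through the top of `v` is at most the potential brought in, up to
  -- `η`. Finite horizons `k` replace the limiting hitting probability; `η` may depend on `v`, `x`
  -- and `y`.
  Bound : Word → ℕ → ℕ → Set
  Bound v x y = ∃ λ η → BoundedSums η ×
    ∀ k → ι y ℚ.* h k (nbr v 0) ℚ.≤ ι x ℚ.* h k (node v) ℚ.+ η k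

  bound-start : ∀ v x → Bound v x 0
  bound-start v x = _ , BoundedSums-0 , λ k → subst₂ ℚ._≤_ (sym (ι0-* (h k (nbr v 0)))) (sym (ℚₚ.+-identityʳ _))
    (*-nonNeg (0≤ι x) (h-nonNeg k (node v)))

  bound-in : ∀ v {x x' y} → x ≤ x' → Bound v x y → Bound v x' y
  bound-in v x≤x' (η , s , g) = η , s , λ k → ℚₚ.≤-trans (g k) (ℚₚ.+-monoˡ-≤ (η k)
    (ℚₚ.*-monoʳ-≤-nonNeg (h k (node v)) {{ℚ.nonNegative (h-nonNeg k (node v))}} (ι-mono x≤x')))

  bound-sum : ∀ n (z : ℕ → ℕ) y (c : ℕ → ℚ) (f : ℕ → ℕ → ℚ) →
    (∀ i → i < n → ∃ λ η → BoundedSums η × ∀ k → ι (z i) ℚ.* c k ℚ.≤ ι y ℚ.* f k i ℚ.+ η k) →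
    ∃ λ η → BoundedSums η × ∀ k → ι (∑ n z) ℚ.* c k ℚ.≤ ι y ℚ.* ∑ℚ n (f k) ℚ.+ η k
  bound-sum zero z y c f g = _ , BoundedSums-0 , λ k → ℚₚ.≤-reflexive
    (trans (ι0-* (c k)) (sym (trans (ℚₚ.+-identityʳ _) (ℚₚ.*-zeroʳ (ι y)))))
  bound-sum (suc n) z y c f g
    with g 0 (s≤s z≤n) | bound-sum n (λ i → z (suc i)) y c (λ k i → f k (suc i)) (λ i i<n → g (suc i) (s≤s i<n))
  ... | η , s , h₁ | θ , t , h₂ = _ , BoundedSums-+ s t , λ k → subst₂ ℚ._≤_
    (trans (sym (ℚₚ.*-distribʳ-+ (c k) (ι (z 0)) _)) (cong (ℚ._* c k) (sym (ι-+ (z 0) _))))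
    (solve 5 (λ y a d e f → (y :* a :+ e) :+ (y :* d :+ f) := y :* (a :+ d) :+ (e :+ f)) refl
      (ι y) (f k 0) (∑ℚ n (λ i → f k (suc i))) (η k) (θ k))
    (ℚₚ.+-mono-≤ (h₁ k) (h₂ k))
    where open +-*-Solver

  offset-𝟎 : ∀ {v} → Valid (b T) v → offset 𝟎 v ≡ 0
  offset-𝟎 valid-[]          = refl
  offset-𝟎 (valid-∷ _ 1≤i _) = ⟦≤⟧-zero 1≤i

  -- The recursion expresses `h (suc k)` at `v` through `h k` at the neighbours. Replacing it by
  -- `h k` at `v` costs an increment `φ (suc k)`, weighted by the total number of departures, and
  -- such errors have bounded sums.
  bound-up : ∀ v → Valid (b T) v → ∀ x y (z : ℕ → ℕ) →
    (∀ i → i < b T v → Bound (suc i ∷ v) (suc y) (z i)) →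
    x ℕ.+ ∑ (b T v) z ℕ.+ 0 ≡ suc (b T v) ℕ.* suc y ℕ.+ offset 𝟎 v →
    Bound v x (suc y)
  bound-up v vv x y z kid bal = pass
    (bound-sum (b T v) z (suc y) (λ k → h k (node v)) (λ k i → h k (node (suc i ∷ v))) kid)
    where
    balance : suc (b T v) ℕ.* suc y ≡ x ℕ.+ ∑ (b T v) z
    balance = trans (sym (ℕₚ.+-identityʳ _))
      (trans (cong (suc (b T v) ℕ.* suc y ℕ.+_) (sym (offset-𝟎 vv))) (trans (sym bal) (ℕₚ.+-identityʳ _)))
    pass : (∃ λ η → BoundedSums η × ∀ k → ι (∑ (b T v) z) ℚ.* h k (node v) ℚ.≤
             ι (suc y) ℚ.* ∑ℚ (b T v) (λ i → h k (node (suc i ∷ v))) ℚ.+ η k) →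
           Bound v x (suc y)
    pass (η , s , g) = _ , BoundedSums-+ s (BoundedSums-* (suc (b T v) ℕ.* suc y) (φ-summable vv)) , λ k →
      transfer {suc (b T v)} {suc y} balance
        (trans (cong (deg v ℚ.*_) (sym (h-suc k (node v)))) (h-rec k vv)) (g k)

  private module Z = Rotor T 𝟎 (λ _ _ → z≤n) Bound (λ v → bound-start v (offset 𝟎 v)) bound-in bound-up

  escapes-𝟎 : ∀ n e → HasE T 𝟎 n e → αTimes≤ T n e
  escapes-𝟎 n e run ε 0<ε = conclude (Z.final-inv run)
    where
    Goal = ∃ λ k → (1ℚ ℚ.- R T k) ℚ.* (ℤ.+ n ℚ./ 1) ℚ.≤ (ℤ.+ e ℚ./ 1) ℚ.+ ε
    few : ∀ {u} → u + e ≡ n → Bound [] n u → Goal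
    -- At `[]` the parent is `ρ`, where `h` is 1, so `Bound` limits the number of returns `u`
    -- itself. The witness is `suc k` because `h k (node [])` is `R T (suc k)`.
    few {u} c (η , s , g) = suc k , complement {R T (suc k)} c returns
      where
      k = proj₁ (small-term s 0<ε)
      returns : ι u ℚ.≤ ι n ℚ.* R T (suc k) ℚ.+ ε
      returns = ℚₚ.≤-trans (subst₂ ℚ._≤_
        (trans (cong (ι u ℚ.*_) (h-ρ k)) (ℚₚ.*-identityʳ _))
        (cong (λ x → ι n ℚ.* x ℚ.+ η k) (h-R k)) (g k))
        (ℚₚ.+-monoʳ-≤ (ι n ℚ.* R T (suc k)) (proj₂ (small-term s 0<ε)))
    conclude : (∃ λ r → ∃ λ U → Z.Inv n ρ r U × U [] + e ≡ n) → Goal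
    conclude (r , U , I , c) = few c (Z.bounded I [] valid-[])

theorem2 : (T : Tree) →
    ((r s : Config) → IsConfig T r → IsConfig T s →
    (∀ w → Valid (b T) w → r w ≤ s w) →
    ∀ n e₁ e₂ → HasE T r n e₁ → HasE T s n e₂ → e₂ ≤ e₁)
    × (∀ n e → HasE T 𝟎 n e → αTimes≤ T n e)
    × (∀ n e → HasE T (𝐛 T) n e → e ≡ 0)
theorem2 T = escapes-antitone T , Hitting.escapes-𝟎 T , no-escapes-𝐛 T
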